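{- The order $(\mathsf{ConnGraph},\leq^{LI})$ of finite connected graphs under locally injective homomorphisms is universal.
   Context: $\mathsf{ConnGraph}$ is the class of all finite connected undirected graphs (loops allowed), considered up to isomorphism. $N_G(v)$ is the set of vertices adjacent to $v$. A graph homomorphism $f:G\to H$ is locally injective if for every $v\in V_G$ the restriction of $f$ to $N_G(v)\to N_H(f(v))$ is injective. $G\leq^{LI}H$ means there is a locally injective homomorphism $G\to H$; on isomorphism classes of finite connected graphs this is a partial order. A countable partial order is universal if every countable partial order $(P,\leq_P)$ embeds into it, i.e. there is a map $E$ with $a\leq_P b\iff E(a)\leq E(b)$ for all $a,b\in P$. -}

module Defs where

open import Level using (Level; 0ℓ; _⊔_) renaming (suc to lsuc)
open import Data.Bool.Base using (Bool; T)
open import Data.Fin.Base using (Fin; toℕ; funToFin; finToFun)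
open import Data.Fin.Properties using (pigeonhole; finToFun-funToFin)
open import Data.Nat.Base using (ℕ; zero; suc; _+_; _^_)
open import Data.Nat.Properties using (n<1+n; +-comm; +-suc; m≤n⇒∃[o]m+o≡n)
open import Data.Product.Base using (Σ; ∃-syntax; _×_; _,_)
open import Function.Base using (id; _∘_)
open import Function.Bundles using (_⇔_; _↔_; Injection; Inverse; Equivalence; mk⇔; mk↔ₛ′)
open import Function.Construct.Composition using (_⇔-∘_; _↔-∘_)
open import Function.Construct.Identity using (⇔-id; ↔-id)
open import Function.Construct.Symmetry using (↔-sym)
open import Relation.Binary.Bundles using (Poset)
open import Relation.Binary.Construct.Closure.ReflexiveTransitive using (Star; ε; _◅_)
open import Relation.Binary.PropositionalEquality
  using (_≡_; _≗_; refl; sym; trans; cong; subst; subst₂; setoid; module ≡-Reasoning)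

-- Graphs are only considered up to isomorphism, so the vertex set may be
-- taken to be Fin n.  A vertex v carries a loop when  adj v v  is true.

record Graph : Set where
  field
    order   : ℕ
    adj     : Fin order → Fin order → Bool
    adj-sym : ∀ u v → adj u v ≡ adj v u

  Vertex : Set
  Vertex = Fin order

  Adj : Vertex → Vertex → Set
  Adj u v = T (adj u v)

open Graph using (order; Vertex; Adj)

-- The graph without vertices does not count as connected.

Connected : Graph → Set
Connected G = Vertex G × (∀ u v → Star (Adj G) u v)

record ConnGraph : Set where
  field
    graph     : Graph
    connected : Connected graph

open ConnGraph using (graph; connected)

infix 4 _≅_ _≤LI_

record _≅_ (G H : Graph) : Set where
  constructor mk≅
  field
    vertices : Vertex G ↔ Vertex H

  open Inverse vertices public using (to; from; strictlyInverseˡ; strictlyInverseʳ)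

  field
    edges : ∀ u v → Adj G u v ⇔ Adj H (to u) (to v)

IsHomomorphism : (G H : Graph) → (Vertex G → Vertex H) → Set
IsHomomorphism G H f = ∀ {u v} → Adj G u v → Adj H (f u) (f v)

IsLocallyInjective : (G H : Graph) → (Vertex G → Vertex H) → Set
IsLocallyInjective G H f = ∀ v {u w} → Adj G v u → Adj G v w → f u ≡ f w → u ≡ w

record _≤LI_ (G H : Graph) : Set where
  constructor mk≤LI
  field
    map               : Vertex G → Vertex H
    homomorphism      : IsHomomorphism G H map
    locally-injective : IsLocallyInjective G H map

open _≤LI_

≤LI-refl : ∀ {G} → G ≤LI G
≤LI-refl = mk≤LI id id (λ _ _ _ → id)

≤LI-trans : ∀ {G H K} → G ≤LI H → H ≤LI K → G ≤LI K
≤LI-trans (mk≤LI f f-hom f-inj) (mk≤LI g g-hom g-inj) =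
  mk≤LI (g ∘ f) (g-hom ∘ f-hom)
    (λ v p q eq → f-inj v p q (g-inj (f v) (f-hom p) (f-hom q) eq))

≅⇒≤LI : ∀ {G H} → G ≅ H → G ≤LI H
≅⇒≤LI φ = mk≤LI to (Equivalence.to (edges _ _)) (λ _ {u} {w} _ _ eq →
    trans (sym (strictlyInverseʳ u)) (trans (cong from eq) (strictlyInverseʳ w)))
  where open _≅_ φ

≅-refl : ∀ {G} → G ≅ G
≅-refl = mk≅ (↔-id _) (λ _ _ → ⇔-id _)

≅-sym : ∀ {G H} → G ≅ H → H ≅ G
≅-sym {G} {H} φ = mk≅ (↔-sym vertices) λ u v → mk⇔
  (λ p → Equivalence.from (edges _ _)
    (subst₂ (Adj H) (sym (strictlyInverseˡ u)) (sym (strictlyInverseˡ v)) p))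
  (λ p → subst₂ (Adj H) (strictlyInverseˡ u) (strictlyInverseˡ v)
    (Equivalence.to (edges _ _) p))
  where open _≅_ φ

≅-trans : ∀ {G H K} → G ≅ H → H ≅ K → G ≅ K
≅-trans (mk≅ φ φ-edges) (mk≅ ψ ψ-edges) =
  mk≅ (ψ ↔-∘ φ) (λ u v → ψ-edges _ _ ⇔-∘ φ-edges u v)

-- Antisymmetry rests on the fact that every locally injective endomorphism h
-- of a finite connected graph has finite order.  By the pigeonhole principle
-- h^(i+q) = h^i for some i and some q > 0, so h^q fixes some vertex.  If h^q
-- fixes w and u is a neighbour of w, then u and h^q(u) are neighbours of w
-- with the same image under the locally injective map h^i, so h^q fixes u.

module _ {G : Graph} (h : G ≤LI G) where

  power : ℕ → G ≤LI G
  power zero    = ≤LI-refl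
  power (suc k) = ≤LI-trans (power k) h

  iter : ℕ → Vertex G → Vertex G
  iter k = map (power k)

  iter-+ : ∀ m k → iter (m + k) ≗ iter m ∘ iter k
  iter-+ zero    k x = refl
  iter-+ (suc m) k x = cong (map h) (iter-+ m k x)

  iter-suc : ∀ k → iter (suc k) ≗ iter k ∘ map h
  iter-suc zero    x = refl
  iter-suc (suc k) x = cong (map h) (iter-suc k x)

  iter-eventually-periodic : ∃[ i ] ∃[ p ] iter (i + suc p) ≗ iter i
  iter-eventually-periodic
    with i , j , i<j , eq ← pigeonhole (n<1+n (order G ^ order G))
                              (λ k → funToFin (iter (toℕ k)))
    with p , 1+i+p≡j ← m≤n⇒∃[o]m+o≡n i<j
    = toℕ i , p , λ x → begin
      iter (toℕ i + suc p) x                ≡⟨ cong (λ k → iter k x) (trans (+-suc _ p) 1+i+p≡j) ⟩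
      iter (toℕ j) x                        ≡⟨ finToFun-funToFin _ x ⟨
      finToFun (funToFin (iter (toℕ j))) x  ≡⟨ cong (λ c → finToFun c x) eq ⟨
      finToFun (funToFin (iter (toℕ i))) x  ≡⟨ finToFun-funToFin _ x ⟩
      iter (toℕ i) x                        ∎
    where open ≡-Reasoning

  finite-order : Connected G → ∃[ p ] iter (suc p) ≗ id
  finite-order (x₀ , walk) with i , p , per ← iter-eventually-periodic =
    p , λ x → spread (walk (iter i x₀) x) start
    where
    q = suc p

    start : iter q (iter i x₀) ≡ iter i x₀
    start = trans (sym (iter-+ q i x₀))
              (trans (cong (λ k → iter k x₀) (+-comm q i)) (per x₀))

    step : ∀ {w u} → Adj G w u → iter q w ≡ w → iter q u ≡ u
    step {w} {u} wu fix = locally-injective (power i) w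
      (subst (λ z → Adj G z (iter q u)) fix (homomorphism (power q) wu)) wu
      (trans (sym (iter-+ i q u)) (per u))

    spread : ∀ {w x} → Star (Adj G) w x → iter q w ≡ w → iter q x ≡ x
    spread ε        fix = fix
    spread (e ◅ es) fix = spread es (step e fix)

≤LI-antisym : ∀ {G H} → Connected G → Connected H → G ≤LI H → H ≤LI G → G ≅ H
≤LI-antisym {G} {H} G-conn H-conn F@(mk≤LI f f-hom _) K@(mk≤LI g g-hom _)
  with p , gf^ ← finite-order (≤LI-trans F K) G-conn
  with r , fg^ ← finite-order (≤LI-trans K F) H-conn
  = mk≅ (mk↔ₛ′ f l fl lf) λ u v → mk⇔ f-hom
      (λ e → subst₂ (Adj G) (lf u) (lf v) (homomorphism (power gf p) (g-hom e)))
  where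
  gf = ≤LI-trans F K
  fg = ≤LI-trans K F

  l s : Vertex H → Vertex G
  l = iter gf p ∘ g
  s = g ∘ iter fg r

  lf : ∀ x → l (f x) ≡ x
  lf x = trans (sym (iter-suc gf p x)) (gf^ x)

  fl : ∀ y → f (l y) ≡ y
  fl y = begin
    f (l y)          ≡⟨ cong (f ∘ l) (fg^ y) ⟨
    f (l (f (s y)))  ≡⟨ cong f (lf (s y)) ⟩
    f (s y)          ≡⟨ fg^ y ⟩
    y                ∎
    where open ≡-Reasoning

ConnGraph-poset : Poset 0ℓ 0ℓ 0ℓ
ConnGraph-poset = record
  { Carrier        = ConnGraph
  ; _≈_            = λ G H → graph G ≅ graph H
  ; _≤_            = λ G H → graph G ≤LI graph H
  ; isPartialOrder = record
    { isPreorder = record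
      { isEquivalence = record
        { refl  = ≅-refl
        ; sym   = ≅-sym
        ; trans = ≅-trans
        }
      ; reflexive = ≅⇒≤LI
      ; trans     = ≤LI-trans
      }
    ; antisym = λ {G} {H} → ≤LI-antisym (connected G) (connected H)
    }
  }

-- Finite sets, including the empty one, are countable.  Elements are counted
-- up to the equality _≈_ of the poset.

Countable : ∀ {c ℓ₁ ℓ₂} → Poset c ℓ₁ ℓ₂ → Set (c ⊔ ℓ₁)
Countable P = Injection (Poset.Eq.setoid P) (setoid ℕ)

-- By antisymmetry such a map automatically respects and reflects _≈_.

EmbedsInto : ∀ {a ℓ₁ ℓ₂ b ℓ₃ ℓ₄} → Poset a ℓ₁ ℓ₂ → Poset b ℓ₃ ℓ₄ → Set (a ⊔ ℓ₂ ⊔ b ⊔ ℓ₄)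
EmbedsInto P Q = Σ (P.Carrier → Q.Carrier) λ E → ∀ a b → a P.≤ b ⇔ E a Q.≤ E b
  where
  module P = Poset P
  module Q = Poset Q

-- The levels c, ℓ₁, ℓ₂ are those of the posets to be embedded.

Universal : ∀ c ℓ₁ ℓ₂ {b ℓ₃ ℓ₄} → Poset b ℓ₃ ℓ₄ → Set (lsuc (c ⊔ ℓ₁ ⊔ ℓ₂) ⊔ b ⊔ ℓ₃ ⊔ ℓ₄)
Universal c ℓ₁ ℓ₂ Q =
  Countable Q × (∀ (P : Poset c ℓ₁ ℓ₂) → Countable P → EmbedsInto P Q)

{-# OPTIONS --safe #-}
module Submission where

-- Let ⊑ be a partial order on ℕ.  Define k y = 2 ∏ {p z | z < y} and
-- p y = k y + 1 recursively; the numbers p y are pairwise coprime.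
-- Put N x = ∏ {p z | z ≤ x, x ⊑ z}.  Then N y ∣ N x implies x ⊑ y, and the
-- converse holds for y ≤ x.  The graph G x consists of a ring of N x vertices,
-- each carrying a pendant vertex (its tip), and of a copy of G y for every
-- y < x with y ⊑ x.  The tip at position k y of the ring of x is joined to the
-- tip at position k y of the copy of G y, and the tip at position 0
-- carries a loop.  (In the code k, p, N are slot, modulus, ring.)
--
-- Let x ⊑ x′.  If x < x′, then G x is contained in G x′.  If x′ < x, wrap the
-- ring of x around the ring of x′.  Copies of G y with y < x′ are mapped
-- identically, and those with y > x′ are wrapped recursively; as N x′ ∣ k y,
-- the edge joining such a copy is mapped to the loop at the tip at position 0.
--
-- Conversely, ring vertices have degree at least 3 and tips degree at most 2,
-- so a locally injective homomorphism G x → G x′ wraps the ring of x around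
-- the ring of some copy of G y in G x′.  Hence N y ∣ N x and x ⊑ y ⊑ x′.

open import Defs
open import Level using (_⊔_)
open import Axiom.ExcludedMiddle using (ExcludedMiddle)
open import Data.Bool.Base using (T)
open import Data.Fin.Base using (Fin; zero; suc; toℕ; fromℕ<; funToFin; finToFun)
open import Data.Fin.Properties using (toℕ<n; toℕ-fromℕ<; toℕ-injective; finToFun-funToFin; 2↔Bool)
open import Data.List.Base as List using (List; []; _∷_; _++_; allFin; concatMap; upTo; lookup; length; deduplicate)
open import Data.List.Membership.Propositional using (_∈_; lose)
open import Data.List.Membership.Propositional.Properties
  using (∈-map⁺; ∈-++⁺ˡ; ∈-++⁺ʳ; ∈-concatMap⁺; ∈-allFin; ∈-upTo⁺; ∈-lookup; ∈-deduplicate⁺)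
import Data.List.Relation.Unary.All as All
open import Data.List.Relation.Unary.AllPairs using ([]; _∷_)
open import Data.List.Relation.Unary.Any using (index)
open import Data.List.Relation.Unary.Any.Properties using (lookup-index)
open import Data.List.Relation.Unary.Unique.DecPropositional.Properties using (deduplicate-!)
open import Data.List.Relation.Unary.Unique.Propositional using (Unique)
open import Data.Nat.Base hiding (_⊔_)
open import Data.Nat.Coprimality as Coprimality using (Coprime; coprime-divisor)
open import Data.Nat.Divisibility
open import Data.Nat.DivMod
open import Data.Nat.Induction using (<-rec)
open import Data.Nat.Properties
open import Data.Product.Base using (∃-syntax; _×_; _,_; proj₁; proj₂)
open import Data.Sum.Base using (_⊎_; inj₁; inj₂)
open import Function.Base using (_∘_; id)
open import Function.Bundles using (_⇔_; mk⇔; Injection; Inverse)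
open import Function.Construct.Composition using (_⇔-∘_)
open import Function.Construct.Identity using (↔-id)
open import Function.Construct.Symmetry using (↔-sym)
open import Function.Properties.Inverse using (↔⇒↣)
open import Level using (0ℓ; Lift; lift; lower)
open import Relation.Binary.Bundles using (Poset)
open import Relation.Binary.Construct.Closure.ReflexiveTransitive using (Star; ε; _◅_; _◅◅_; gmap; reverse)
open import Relation.Binary.Core using (Rel)
open import Relation.Binary.Definitions using (DecidableEquality; Symmetric; tri<; tri≈; tri>)
open import Relation.Binary.PropositionalEquality as ≡
  using (_≡_; _≢_; _≗_; refl; sym; trans; cong; subst; subst₂; module ≡-Reasoning)
open import Relation.Binary.Structures using (IsDecPartialOrder)
open import Relation.Nullary.Decidable using (_×-dec_; isYes≗does; does-⇔)
open import Relation.Nullary.Decidable.Core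
  using (Dec; yes; no; T?; True; ⌊_⌋; recompute; map′; toWitness; fromWitness)
open import Relation.Nullary.Negation.Core using (¬_; contradiction)

-- Countability of the isomorphism classes

-- 2 ^ m times an odd number.
pair : ℕ → ℕ → ℕ
pair zero    n = suc (2 * n)
pair (suc m) n = 2 * pair m n

pair-injective : ∀ m m′ {n n′} → pair m n ≡ pair m′ n′ → m ≡ m′ × n ≡ n′
pair-injective zero    zero     eq = refl , *-cancelˡ-≡ _ _ 2 (suc-injective eq)
pair-injective zero    (suc m′) {n} {n′} eq = contradiction (sym eq) (even≢odd (pair m′ n′) n)
pair-injective (suc m) zero     {n} {n′} eq = contradiction eq (even≢odd (pair m n) n′)
pair-injective (suc m) (suc m′) eq
  with refl , n≡n′ ← pair-injective m m′ (*-cancelˡ-≡ _ _ 2 eq) = refl , n≡n′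

funToFin-injective : ∀ {m n} {f g : Fin m → Fin n} → funToFin f ≡ funToFin g → f ≗ g
funToFin-injective {f = f} {g} eq i = trans (sym (finToFun-funToFin f i))
  (trans (cong (λ c → finToFun c i) eq) (finToFun-funToFin g i))

code : Graph → ℕ
code G = pair order (toℕ (funToFin (λ u → funToFin (λ v → Inverse.from 2↔Bool (adj u v)))))
  where open Graph G

code-injective : ∀ G H → code G ≡ code H → G ≅ H
code-injective G H eq with refl , eq′ ← pair-injective (Graph.order G) (Graph.order H) eq =
  mk≅ (↔-id _) λ u v → mk⇔ (subst T (adj≡ u v)) (subst T (sym (adj≡ u v)))
  where
  adj≡ : ∀ u v → Graph.adj G u v ≡ Graph.adj H u v
  adj≡ u v = Injection.injective (↔⇒↣ (↔-sym 2↔Bool))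
    (funToFin-injective (funToFin-injective (toℕ-injective eq′) u) v)

module _ (em : ExcludedMiddle 0ℓ) where

  IsLeast : (ℕ → Set) → ℕ → Set
  IsLeast P n = P n × (∀ {m} → P m → n ≤ m)

  least : ∀ {P : ℕ → Set} n → P n → ∃[ m ] IsLeast P m
  least {P} = <-rec _ λ n rec Pn → case-em n rec Pn em
    where
    case-em : ∀ n → (∀ {m} → m < n → P m → ∃[ k ] IsLeast P k) → P n →
              Dec (∃[ m ] m < n × P m) → ∃[ k ] IsLeast P k
    case-em n rec Pn (yes (m , m<n , Pm)) = rec m<n Pm
    case-em n rec Pn (no none) = n , Pn , λ {m} Pm → ≮⇒≥ λ m<n → none (m , m<n , Pm)

  -- The least code in the isomorphism class of a graph is an invariant.
  HasCode : Graph → ℕ → Set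
  HasCode G n = ∃[ H ] G ≅ H × code H ≡ n

  leastCode : ∀ G → ∃[ n ] IsLeast (HasCode G) n
  leastCode G = least (code G) (G , ≅-refl , refl)

  HasCode-resp : ∀ {G H n} → G ≅ H → HasCode G n → HasCode H n
  HasCode-resp G≅H (K , G≅K , eq) = K , ≅-trans (≅-sym G≅H) G≅K , eq

  ConnGraph-countable : Countable ConnGraph-poset
  ConnGraph-countable = record
    { to        = λ G → proj₁ (leastCode (graph G))
    ; cong      = λ G≅H → ≤-antisym (bound G≅H) (bound (≅-sym G≅H))
    ; injective = λ {G} {H} → injective (graph G) (graph H)
    }
    where
    open ConnGraph
    bound : ∀ {G H} → G ≅ H → proj₁ (leastCode G) ≤ proj₁ (leastCode H)
    bound {G} {H} G≅H with _ , _ , G-min ← leastCode G | _ , H-code , _ ← leastCode H =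
      G-min (HasCode-resp (≅-sym G≅H) H-code)
    injective : ∀ G H → proj₁ (leastCode G) ≡ proj₁ (leastCode H) → G ≅ H
    injective G H eq with leastCode G | leastCode H
    ... | _ , (K , G≅K , refl) , _ | _ , (L , H≅L , refl) , _ =
      ≅-trans G≅K (≅-trans (code-injective K L eq) (≅-sym H≅L))

-- Realising graphs on arbitrary finite types as graphs on `Fin n`

lookup-injective : ∀ {a} {A : Set a} {xs : List A} → Unique xs →
                   ∀ i j → lookup xs i ≡ lookup xs j → i ≡ j
lookup-injective (x∉xs ∷ xs!) zero    zero    eq = refl
lookup-injective (x∉xs ∷ xs!) zero    (suc j) eq = contradiction eq (All.lookup x∉xs (∈-lookup j))
lookup-injective (x∉xs ∷ xs!) (suc i) zero    eq = contradiction (sym eq) (All.lookup x∉xs (∈-lookup i))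
lookup-injective (x∉xs ∷ xs!) (suc i) (suc j) eq = cong suc (lookup-injective xs! i j eq)

-- The list of vertices may have repetitions.
record FiniteGraph : Set₁ where
  field
    V        : Set
    vertices : List V
    complete : ∀ v → v ∈ vertices
    _∼_      : Rel V 0ℓ
    ∼-sym    : Symmetric _∼_

module Realisation (em : ExcludedMiddle 0ℓ) (G : FiniteGraph) where
  open FiniteGraph G

  _≟′_ : DecidableEquality V
  u ≟′ v = em

  -- Repetitions are removed so that `decode` is injective and inverse to `encode`.
  list : List V
  list = deduplicate _≟′_ vertices

  decode : Fin (length list) → V
  decode = lookup list

  encode : V → Fin (length list)
  encode v = index (∈-deduplicate⁺ _≟′_ (complete v))

  decode-encode : ∀ v → decode (encode v) ≡ v
  decode-encode v = sym (lookup-index (∈-deduplicate⁺ _≟′_ (complete v)))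

  decode-injective : ∀ {i j} → decode i ≡ decode j → i ≡ j
  decode-injective {i} {j} = lookup-injective (deduplicate-! _≟′_ vertices) i j

  graph : Graph
  graph = record
    { order   = length list
    ; adj     = λ i j → ⌊ em {decode i ∼ decode j} ⌋
    ; adj-sym = λ i j → trans (isYes≗does em)
        (trans (does-⇔ (mk⇔ ∼-sym ∼-sym) em em) (sym (isYes≗does em)))
    }
  open Graph graph using (Adj)

  Adj⇒∼ : ∀ {i j} → Adj i j → decode i ∼ decode j
  Adj⇒∼ = toWitness

  ∼⇒Adj : ∀ {u v} → u ∼ v → Adj (encode u) (encode v)
  ∼⇒Adj {u} {v} p = fromWitness (subst₂ _∼_ (sym (decode-encode u)) (sym (decode-encode v)) p)

  encode-decode : ∀ i → encode (decode i) ≡ i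
  encode-decode i = decode-injective (decode-encode (decode i))

  connected : (r : V) → (∀ v → Star _∼_ v r) → Connected graph
  connected r path = encode r , λ i j → subst₂ (Star Adj) (encode-decode i) (encode-decode j)
    (gmap encode ∼⇒Adj (path (decode i) ◅◅ reverse ∼-sym (path (decode j))))

infix 4 _≤LI′_

record _≤LI′_ (G H : FiniteGraph) : Set where
  private
    module G = FiniteGraph G
    module H = FiniteGraph H
  field
    to  : G.V → H.V
    hom : ∀ {u v} → u G.∼ v → to u H.∼ to v
    inj : ∀ {u v w} → u G.∼ v → u G.∼ w → to v ≡ to w → v ≡ w

module _ (em : ExcludedMiddle 0ℓ) {G H : FiniteGraph} where
  private
    module G = Realisation em G
    module H = Realisation em H

  ≤LI⁺ : G ≤LI′ H → G.graph ≤LI H.graph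
  ≤LI⁺ f = record
    { map = H.encode ∘ to ∘ G.decode
    ; homomorphism = H.∼⇒Adj ∘ hom ∘ G.Adj⇒∼
    ; locally-injective = λ _ p q eq → G.decode-injective (inj (G.Adj⇒∼ p) (G.Adj⇒∼ q)
       (trans (sym (H.decode-encode _)) (trans (cong H.decode eq) (H.decode-encode _))))
    }
    where open _≤LI′_ f

  ≤LI⁻ : G.graph ≤LI H.graph → G ≤LI′ H
  ≤LI⁻ f = record
    { to  = H.decode ∘ map ∘ G.encode
    ; hom = H.Adj⇒∼ ∘ homomorphism ∘ G.∼⇒Adj
    ; inj = λ p q eq → trans (sym (G.decode-encode _)) (trans (cong G.decode
        (locally-injective _ (G.∼⇒Adj p) (G.∼⇒Adj q) (H.decode-injective eq))) (G.decode-encode _))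
    }
    where open _≤LI_ f

-- Residues and coprimality

suc-cancel-% : ∀ m n d .{{_ : NonZero d}} → suc m % d ≡ suc n % d → m % d ≡ n % d
suc-cancel-% m n d@(suc d-1) eq = begin
  m % d                                ≡⟨ step-down m ⟨
  (suc m % d + d-1 % d) % d            ≡⟨ cong (λ r → (r + d-1 % d) % d) eq ⟩
  (suc n % d + d-1 % d) % d            ≡⟨ step-down n ⟩
  n % d                                ∎
  where
  open ≡-Reasoning
  -- Adding `d-1` undoes `suc` modulo `d`.
  step-down : ∀ k → (suc k % d + d-1 % d) % d ≡ k % d
  step-down k = begin
    (suc k % d + d-1 % d) % d  ≡⟨ %-distribˡ-+ (suc k) d-1 d ⟨
    (suc k + d-1) % d          ≡⟨ cong (_% d) (+-suc k d-1) ⟨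
    (k + d) % d                ≡⟨ [m+n]%n≡m%n k d ⟩
    k % d                      ∎

+-cancelˡ-% : ∀ a m n d .{{_ : NonZero d}} → (a + m) % d ≡ (a + n) % d → m % d ≡ n % d
+-cancelˡ-% zero    m n d eq = eq
+-cancelˡ-% (suc a) m n d eq = +-cancelˡ-% a m n d (suc-cancel-% (a + m) (a + n) d eq)

[a+t]%d≡a%d⇒d∣t : ∀ a t d .{{_ : NonZero d}} → (a + t) % d ≡ a % d → d ∣ t
[a+t]%d≡a%d⇒d∣t a t d eq = m%n≡0⇒n∣m t d (trans
  (+-cancelˡ-% a t 0 d (trans eq (cong (_% d) (sym (+-identityʳ a)))))
  (n∣m⇒m%n≡0 0 d (d ∣0)))

suc-%-% : ∀ m d .{{_ : NonZero d}} → suc (m % d) % d ≡ suc m % d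
suc-%-% m d = begin
  suc (m % d) % d          ≡⟨ %-distribˡ-+ 1 (m % d) d ⟩
  (1 % d + m % d % d) % d  ≡⟨ cong (λ r → (1 % d + r) % d) (m%n%n≡m%n m d) ⟩
  (1 % d + m % d) % d      ≡⟨ %-distribˡ-+ 1 m d ⟨
  suc m % d                ∎
  where open ≡-Reasoning

coprime-* : ∀ {m n o} → Coprime m n → Coprime m o → Coprime m (n * o)
coprime-* {m} {n} {o} m⊥n m⊥o {d} (d∣m , d∣n*o) =
  m⊥o (d∣m , coprime-divisor d⊥n d∣n*o)
  where
  d⊥n : Coprime d n
  d⊥n (e∣d , e∣n) = m⊥n (∣-trans e∣d d∣m , e∣n)

-- Pairwise coprime moduli

-- The start value 2 gives every ring at least 3 vertices.
slot : ℕ → ℕ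
slot zero    = 2
slot (suc n) = slot n * suc (slot n)

-- Sylvester's sequence without its first term: 3, 7, 43, 1807, ...
modulus : ℕ → ℕ
modulus n = suc (slot n)

slot≥2 : ∀ n → 2 ≤ slot n
slot≥2 zero    = ≤-refl
slot≥2 (suc n) = ≤-trans (slot≥2 n) (m≤m*n (slot n) (modulus n))

slot≢0 : ∀ n → slot n ≢ 0
slot≢0 n = n>0⇒n≢0 (≤-trans (s≤s z≤n) (slot≥2 n))

slot-<-suc : ∀ n → slot n < slot (suc n)
slot-<-suc n = m<m*n (slot n) (modulus n) {{≢-nonZero (slot≢0 n)}} (s≤s (≤-trans (s≤s z≤n) (slot≥2 n)))

≤-step-induction : ∀ {ℓ} {R : Rel ℕ ℓ} → (∀ {n} → R n n) → (∀ {l m n} → R l m → R m n → R l n) →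
                   (∀ n → R n (suc n)) → ∀ {m n} → m ≤′ n → R m n
≤-step-induction rfl trn stp ≤′-refl        = rfl
≤-step-induction rfl trn stp (≤′-step m≤′n) = trn (≤-step-induction rfl trn stp m≤′n) (stp _)

slot-∣ : ∀ {m n} → m ≤ n → slot m ∣ slot n
slot-∣ m≤n = ≤-step-induction {R = λ m n → slot m ∣ slot n} ∣-refl ∣-trans
  (λ n → m∣m*n (modulus n)) (≤⇒≤′ m≤n)

slot-mono-≤ : ∀ {m n} → m ≤ n → slot m ≤ slot n
slot-mono-≤ {n = n} m≤n = ∣⇒≤ {{≢-nonZero (slot≢0 n)}} (slot-∣ m≤n)

slot-mono-< : ∀ {m n} → m < n → slot m < slot n
slot-mono-< {m} m<n = <-≤-trans (slot-<-suc m) (slot-mono-≤ m<n)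

slot-injective : ∀ m n → slot m ≡ slot n → m ≡ n
slot-injective m n eq with <-cmp m n
... | tri< m<n _ _ = contradiction eq (<⇒≢ (slot-mono-< m<n))
... | tri≈ _ m≡n _ = m≡n
... | tri> _ _ n<m = contradiction (sym eq) (<⇒≢ (slot-mono-< n<m))

-- `modulus m` is a factor of `slot (suc m)`, hence divides `slot n`, which is one less than
-- `modulus n`.
modulus-coprime-< : ∀ {m n} → m < n → Coprime (modulus m) (modulus n)
modulus-coprime-< {m} {n} m<n {d} (d∣pm , d∣pn) =
  ∣1⇒≡1 (∣m+n∣m⇒∣n (subst (d ∣_) (+-comm 1 (slot n)) d∣pn)
                   (∣-trans (∣n⇒∣m*n (slot m) d∣pm) (slot-∣ m<n)))

modulus-coprime : ∀ {m n} → m ≢ n → Coprime (modulus m) (modulus n)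
modulus-coprime {m} {n} m≢n with <-cmp m n
... | tri< m<n _ _ = modulus-coprime-< m<n
... | tri≈ _ m≡n _ = contradiction m≡n m≢n
... | tri> _ _ n<m = Coprimality.sym (modulus-coprime-< n<m)

-- Ring lengths that encode the order

module Construction {_⊑_ : Rel ℕ 0ℓ} (isDecPartialOrder : IsDecPartialOrder _≡_ _⊑_) where

  open IsDecPartialOrder isDecPartialOrder using ()
    renaming (_≤?_ to _⊑?_; refl to ⊑-refl; trans to ⊑-trans; antisym to ⊑-antisym)

  -- upperProduct x b = ∏ {modulus z | z < b, x ⊑ z}
  upperProduct : ℕ → ℕ → ℕ
  upperProduct x zero    = 1
  upperProduct x (suc b) with x ⊑? b
  ... | yes _ = upperProduct x b * modulus b
  ... | no  _ = upperProduct x b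

  ring : ℕ → ℕ
  ring x = upperProduct x (suc x)

  ring-≡ : ∀ x → ring x ≡ upperProduct x x * modulus x
  ring-≡ x with x ⊑? x
  ... | yes _   = refl
  ... | no x⋢x = contradiction ⊑-refl x⋢x

  upperProduct∣slot : ∀ x b → upperProduct x b ∣ slot b
  upperProduct∣slot x zero    = 1∣ 2
  upperProduct∣slot x (suc b) with x ⊑? b
  ... | yes _ = *-monoˡ-∣ (modulus b) (upperProduct∣slot x b)
  ... | no  _ = ∣m⇒∣m*n (modulus b) (upperProduct∣slot x b)

  -- The factors of `ring x` are among the moduli multiplied up in `slot (suc x)`. This is what lets
  -- `fold` send the link to a copy of a larger index to the loop at position 0.
  ring∣slot : ∀ {x y} → x < y → ring x ∣ slot y
  ring∣slot {x} x<y = ∣-trans (upperProduct∣slot x (suc x)) (slot-∣ x<y)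

  upperProduct-anti : ∀ {x y} → x ⊑ y → ∀ b → upperProduct y b ∣ upperProduct x b
  upperProduct-anti x⊑y zero    = ∣-refl
  upperProduct-anti {x} {y} x⊑y (suc b) with x ⊑? b | y ⊑? b
  ... | yes _   | yes _   = *-monoˡ-∣ (modulus b) (upperProduct-anti x⊑y b)
  ... | yes _   | no  _   = ∣m⇒∣m*n (modulus b) (upperProduct-anti x⊑y b)
  ... | no x⋢b | yes y⊑b = contradiction (⊑-trans x⊑y y⊑b) x⋢b
  ... | no  _   | no  _   = upperProduct-anti x⊑y b

  upperProduct-∣ : ∀ x {b c} → b ≤ c → upperProduct x b ∣ upperProduct x c
  upperProduct-∣ x b≤c =
    ≤-step-induction {R = λ b c → upperProduct x b ∣ upperProduct x c} ∣-refl ∣-trans step (≤⇒≤′ b≤c)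
    where
    step : ∀ b → upperProduct x b ∣ upperProduct x (suc b)
    step b with x ⊑? b
    ... | yes _ = m∣m*n (modulus b)
    ... | no  _ = ∣-refl

  -- By transitivity everything above `y` is above `x`, so each factor of `ring y` occurs in
  -- `ring x`; `y ≤ x` ensures that the product for `x` runs far enough.
  ring-∣ : ∀ {x y} → x ⊑ y → y ≤ x → ring y ∣ ring x
  ring-∣ {x} {y} x⊑y y≤x =
    ∣-trans (upperProduct-anti x⊑y (suc y)) (upperProduct-∣ x (s≤s y≤x))

  -- Each factor belongs to some `z` with `x ⊑ z`, so `z` differs from `y`.
  upperProduct-coprime : ∀ {x y} → ¬ x ⊑ y → ∀ b → Coprime (modulus y) (upperProduct x b)
  upperProduct-coprime x⋢y zero    (_ , d∣1) = ∣1⇒≡1 d∣1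
  upperProduct-coprime {x} {y} x⋢y (suc b) with x ⊑? b
  ... | yes x⊑b = coprime-* (upperProduct-coprime x⋢y b)
                    (modulus-coprime {y} {b} λ { refl → x⋢y x⊑b })
  ... | no  _   = upperProduct-coprime x⋢y b

  modulus∣ring : ∀ x → modulus x ∣ ring x
  modulus∣ring x rewrite ring-≡ x = n∣m*n (upperProduct x x)

  ring-∣⇒⊑ : ∀ {x y} → ring y ∣ ring x → x ⊑ y
  ring-∣⇒⊑ {x} {y} ry∣rx with x ⊑? y
  ... | yes x⊑y = x⊑y
  -- Otherwise `modulus y` would divide a number to which it is coprime, so it would be 1.
  ... | no x⋢y = contradiction
    (suc-injective (upperProduct-coprime x⋢y (suc x) (∣-refl , ∣-trans (modulus∣ring y) ry∣rx)))
    (slot≢0 y)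

  instance
    ring-nonZero : ∀ {x} → NonZero (ring x)
    ring-nonZero {x} = ≢-nonZero λ eq →
      slot≢0 (suc x) (0∣⇒≡0 (subst (_∣ slot (suc x)) eq (ring∣slot (n<1+n x))))

  slot<ring : ∀ {y x} → y ≤ x → slot y < ring x
  slot<ring {y} {x} y≤x = ≤-trans (s≤s (slot-mono-≤ y≤x)) (∣⇒≤ (modulus∣ring x))

  ring∤2 : ∀ x → ring x ∤ 2
  ring∤2 x = >⇒∤ (≤-<-trans (slot≥2 x) (slot<ring ≤-refl))

  -- The labelled graphs

  _≺_ : Rel ℕ 0ℓ
  y ≺ x = y < x × y ⊑ x

  _≺?_ : ∀ y x → Dec (y ≺ x)
  y ≺? x = y <? x ×-dec y ⊑? x

  ≺-recompute : ∀ {x y} → .(y ≺ x) → y ≺ x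
  ≺-recompute {x} {y} = recompute (y ≺? x)

  -- The proof in `copy` is irrelevant, so that a vertex of a copy is determined by `y` and `u`
  -- alone; `≺-recompute` recovers the proof by decidability.
  data Vert (x : ℕ) : Set where
    rim  : Fin (ring x) → Vert x
    tip  : Fin (ring x) → Vert x
    copy : ∀ y → .(y ≺ x) → Vert y → Vert x

  -- A vertex has at most one neighbour along each label, and an edge has only
  -- one label in each direction, so label-preserving maps are locally injective.
  data Label : Set where
    next prev spoke link : Label

  opposite : Label → Label
  opposite next  = prev
  opposite prev  = next
  opposite spoke = spoke
  opposite link  = link

  private variable
    x y : ℕ
    i j : Fin (ring x)
    u v w : Vert x
    l l′ : Label

  Next : Fin (ring x) → Fin (ring x) → Set
  Next {x} i j = toℕ j ≡ suc (toℕ i) % ring x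

  -- The loop has the label `link` so that a link collapsed by `fold` keeps its label. It sits at
  -- position 0, which is no slot, so that it never competes with a link to a copy.
  data Edge {x : ℕ} : Label → Vert x → Vert x → Set where
    next  : Next {x} i j → Edge next (rim i) (rim j)
    prev  : Next {x} j i → Edge prev (rim i) (rim j)
    out   : Edge spoke (rim i) (tip i)
    back  : Edge spoke (tip i) (rim i)
    loop  : toℕ i ≡ 0 → Edge link (tip i) (tip i)
    down  : ∀ {i j} .{y≺x : y ≺ x} → toℕ i ≡ slot y → toℕ j ≡ slot y →
            Edge link (tip i) (copy y y≺x (tip j))
    up    : ∀ {i j} .{y≺x : y ≺ x} → toℕ i ≡ slot y → toℕ j ≡ slot y →
            Edge link (copy y y≺x (tip j)) (tip i)
    inner : ∀ {l} {u v : Vert y} .{y≺x : y ≺ x} →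
            Edge l u v → Edge l (copy y y≺x u) (copy y y≺x v)

  Edge-sym : Edge l u v → Edge (opposite l) v u
  Edge-sym (next p)   = prev p
  Edge-sym (prev p)   = next p
  Edge-sym out        = back
  Edge-sym back       = out
  Edge-sym (loop p)   = loop p
  Edge-sym (down p q) = up p q
  Edge-sym (up p q)   = down p q
  Edge-sym (inner e)  = inner (Edge-sym e)

  Next-injective : ∀ {i i′ j : Fin (ring x)} → Next {x} i j → Next {x} i′ j → i ≡ i′
  Next-injective {x} {i} {i′} p q = toℕ-injective (begin
    toℕ i            ≡⟨ m<n⇒m%n≡m (toℕ<n i) ⟨
    toℕ i % ring x   ≡⟨ suc-cancel-% (toℕ i) (toℕ i′) (ring x) (trans (sym p) q) ⟩
    toℕ i′ % ring x  ≡⟨ m<n⇒m%n≡m (toℕ<n i′) ⟩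
    toℕ i′           ∎)
    where open ≡-Reasoning

  -- Otherwise two steps along the ring would lead back to the start, and `ring x` would divide 2.
  Next-asym : ∀ {i j : Fin (ring x)} → Next {x} i j → ¬ Next {x} j i
  Next-asym {x} {i} {j} p q = ring∤2 x ([a+t]%d≡a%d⇒d∣t (toℕ i) 2 (ring x) (begin
    (toℕ i + 2) % ring x              ≡⟨ cong (_% ring x) (+-comm (toℕ i) 2) ⟩
    suc (suc (toℕ i)) % ring x        ≡⟨ suc-%-% (suc (toℕ i)) (ring x) ⟨
    suc (suc (toℕ i) % ring x) % ring x  ≡⟨ cong (λ n → suc n % ring x) p ⟨
    suc (toℕ j) % ring x              ≡⟨ q ⟨
    toℕ i                             ≡⟨ m<n⇒m%n≡m (toℕ<n i) ⟨
    toℕ i % ring x                    ∎))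
    where open ≡-Reasoning

  -- This is the tip by which copies of the graph of `x` are attached to larger graphs, so it must
  -- have no link inside the copy. Inside, links start only at position 0 and at slots of smaller
  -- indices.
  tip-link : ∀ {i : Fin (ring x)} → toℕ i ≡ slot x → ¬ Edge link (tip i) w
  tip-link {x} p (loop q)   = slot≢0 x (trans (sym p) q)
  tip-link {x} p (down {y≺x = y≺x} q _) =
    <⇒≢ (slot-mono-< (proj₁ (≺-recompute y≺x))) (trans (sym q) p)

  -- The possible conflicts all concern `link`: a loop against a link downwards is excluded as slots
  -- are nonzero, two links downwards agree as `slot` is injective, and a link upwards against one
  -- inside the copy is excluded by `tip-link`.
  Edge-functional : Edge l u v → Edge l u w → v ≡ w
  Edge-functional (next p)   (next q) = cong rim (toℕ-injective (trans p (sym q)))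
  Edge-functional (prev p)   (prev q) = cong rim (Next-injective p q)
  Edge-functional out        out      = refl
  Edge-functional back       back     = refl
  Edge-functional (loop p)   (loop q) = refl
  Edge-functional (loop p)   (down {y = y} q _) = contradiction (trans (sym q) p) (slot≢0 y)
  Edge-functional (down {y = y} p _) (loop q)   = contradiction (trans (sym p) q) (slot≢0 y)
  Edge-functional (down {y = y} {y≺x = y≺x} p p′) (down {y = y′} q q′)
    with refl ← slot-injective y y′ (trans (sym p) q) =
    cong (copy y y≺x ∘ tip) (toℕ-injective (trans p′ (sym q′)))
  Edge-functional (up p p′)   (up q q′)  = cong tip (toℕ-injective (trans p (sym q)))
  Edge-functional (up _ p)    (inner e)  = contradiction e (tip-link p)
  Edge-functional (inner e)   (up _ p)   = contradiction e (tip-link p)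
  Edge-functional (inner e)   (inner e′) = cong (copy _ _) (Edge-functional e e′)

  -- The forms of the two ends determine the label, except on a ring, where `Next-asym` separates
  -- `next` from `prev`.
  Edge-label : Edge l u v → Edge l′ u v → l ≡ l′
  Edge-label (next p)   (next q)   = refl
  Edge-label (next p)   (prev q)   = contradiction q (Next-asym p)
  Edge-label (prev p)   (next q)   = contradiction p (Next-asym q)
  Edge-label (prev p)   (prev q)   = refl
  Edge-label out        out        = refl
  Edge-label back       back       = refl
  Edge-label (loop _)   (loop _)   = refl
  Edge-label (down _ _) (down _ _) = refl
  Edge-label (up _ _)   (up _ _)   = refl
  Edge-label (inner e)  (inner e′) = Edge-label e e′

  -- From the order to label-preserving maps

  fold : ∀ x′ → .(x ⊑ x′) → Vert x → Vert x′
  fold x′ _    (rim i) = rim (toℕ i mod ring x′)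
  fold x′ _    (tip i) = tip (toℕ i mod ring x′)
  fold x′ x⊑x′ (copy y y≺x u) with y <? x′
  ... | yes y<x′ = copy y (y<x′ , ⊑-trans (proj₂ y≺x) x⊑x′) u
  ... | no  _    = fold x′ (⊑-trans (proj₂ y≺x) x⊑x′) u

  toℕ-mod : ∀ m n .{{_ : NonZero n}} → toℕ (m mod n) ≡ m % n
  toℕ-mod m n = toℕ-fromℕ< (m%n<n m n)

  mod-Next : ∀ {x x′} {i j : Fin (ring x)} → ring x′ ∣ ring x → Next {x} i j →
             Next {x′} (toℕ i mod ring x′) (toℕ j mod ring x′)
  mod-Next {x} {x′} {i} {j} d p = begin
    toℕ (toℕ j mod ring x′)              ≡⟨ toℕ-mod (toℕ j) (ring x′) ⟩
    toℕ j % ring x′                      ≡⟨ cong (_% ring x′) p ⟩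
    -- Divisibility makes the wrap-around at `ring x` invisible modulo `ring x′`.
    suc (toℕ i) % ring x % ring x′       ≡⟨ m∣n⇒o%n%m≡o%m (ring x′) (ring x) (suc (toℕ i)) d ⟩
    suc (toℕ i) % ring x′                ≡⟨ suc-%-% (toℕ i) (ring x′) ⟨
    suc (toℕ i % ring x′) % ring x′      ≡⟨ cong (λ n → suc n % ring x′) (toℕ-mod (toℕ i) (ring x′)) ⟨
    suc (toℕ (toℕ i mod ring x′)) % ring x′ ∎
    where open ≡-Reasoning

  mod-slot-< : ∀ {m y x} → y < x → m ≡ slot y → toℕ (m mod ring x) ≡ slot y
  mod-slot-< {m} {y} {x} y<x refl =
    trans (toℕ-mod m (ring x)) (m<n⇒m%n≡m (slot<ring (<⇒≤ y<x)))

  mod-slot-> : ∀ {m y x} → x < y → m ≡ slot y → toℕ (m mod ring x) ≡ 0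
  mod-slot-> {m} {y} {x} x<y refl =
    trans (toℕ-mod m (ring x)) (n∣m⇒m%n≡0 m (ring x) (ring∣slot x<y))

  -- Here `m` and `n` are the positions of the two ends of a link to a copy that gets folded; both
  -- ends land on the tip with the loop.
  fold-loop : ∀ {m n} → toℕ (m mod ring x) ≡ 0 → toℕ (n mod ring x) ≡ 0 →
              Edge {x} link (tip (m mod ring x)) (tip (n mod ring x))
  fold-loop {x} {m} {n} p q
    rewrite toℕ-injective {i = n mod ring x} {j = m mod ring x} (trans q (sym p)) = loop p

  -- y = x′ would give x ⊑ x′ = y ⊑ x with x′ < x.
  copies-beyond : ∀ {x x′ y} → x ⊑ x′ → x′ < x → y ≺ x → ¬ y < x′ → x′ < y
  copies-beyond {x} {x′} {y} x⊑x′ x′<x y≺x y≮x′ =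
    ≤∧≢⇒< (≮⇒≥ y≮x′) λ { refl → <⇒≢ x′<x (⊑-antisym (proj₂ y≺x) x⊑x′) }

  fold-edge : ∀ {x x′} {u v : Vert x} (x⊑x′ : x ⊑ x′) → x′ < x →
              Edge l u v → Edge l (fold x′ x⊑x′ u) (fold x′ x⊑x′ v)
  fold-edge x⊑x′ x′<x (next p) = next (mod-Next (ring-∣ x⊑x′ (<⇒≤ x′<x)) p)
  fold-edge x⊑x′ x′<x (prev p) = prev (mod-Next (ring-∣ x⊑x′ (<⇒≤ x′<x)) p)
  fold-edge x⊑x′ x′<x out = out
  fold-edge x⊑x′ x′<x back = back
  fold-edge {x′ = x′} x⊑x′ x′<x (loop {i = i} p) = loop (begin
    toℕ (toℕ i mod ring x′)  ≡⟨ toℕ-mod (toℕ i) (ring x′) ⟩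
    toℕ i % ring x′          ≡⟨ cong (_% ring x′) p ⟩
    0 % ring x′              ≡⟨ n∣m⇒m%n≡0 0 (ring x′) (ring x′ ∣0) ⟩
    0                        ∎)
    where open ≡-Reasoning
  fold-edge {x′ = x′} x⊑x′ x′<x (down {y = y} {y≺x = y≺x} p q) with y <? x′
  ... | yes y<x′ = down (mod-slot-< y<x′ p) q
  ... | no y≮x′  = fold-loop (mod-slot-> x′<y p) (mod-slot-> x′<y q)
    where x′<y = copies-beyond x⊑x′ x′<x (≺-recompute y≺x) y≮x′
  fold-edge {x′ = x′} x⊑x′ x′<x (up {y = y} {y≺x = y≺x} p q) with y <? x′
  ... | yes y<x′ = up (mod-slot-< y<x′ p) q
  ... | no y≮x′  = fold-loop (mod-slot-> x′<y q) (mod-slot-> x′<y p)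
    where x′<y = copies-beyond x⊑x′ x′<x (≺-recompute y≺x) y≮x′
  fold-edge {x′ = x′} x⊑x′ x′<x (inner {y = y} {y≺x = y≺x} e) with y <? x′
  ... | yes y<x′ = inner e
  -- `copies-beyond` provides the hypothesis `x′ < y` for folding the copy itself.
  ... | no y≮x′  = fold-edge (⊑-trans (proj₂ y≺x′) x⊑x′) (copies-beyond x⊑x′ x′<x y≺x′ y≮x′) e
    where y≺x′ = ≺-recompute y≺x

  ⊑⇒map : ∀ {x x′} → x ⊑ x′ → ∃[ f ] (∀ {l u v} → Edge {x} l u v → Edge {x′} l (f u) (f v))
  ⊑⇒map {x} {x′} x⊑x′ with <-cmp x x′
  ... | tri< x<x′ _ _ = copy x (x<x′ , x⊑x′) , inner
  ... | tri≈ _ refl _ = id , id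
  ... | tri> _ _ x′<x = fold x′ x⊑x′ , fold-edge x⊑x′ x′<x

  -- Finiteness and local injectivity

  infix 4 _~_
  _~_ : Rel (Vert x) 0ℓ
  u ~ v = ∃[ l ] Edge l u v

  ~-sym : Symmetric (_~_ {x})
  ~-sym (l , e) = opposite l , Edge-sym e

  copies : ∀ x y → List (Vert y) → List (Vert x)
  copies x y us with y ≺? x
  ... | yes y≺x = List.map (copy y y≺x) us
  ... | no  _   = []

  ∈-copies : ∀ {us} .(y≺x : y ≺ x) {u : Vert y} → u ∈ us → copy y y≺x u ∈ copies x y us
  ∈-copies {y} {x} y≺x u∈us with y ≺? x
  ... | yes p   = ∈-map⁺ (copy y p) u∈us
  ... | no y⊀x = contradiction (≺-recompute y≺x) y⊀x

  -- The bound `b` makes the recursion structural; it suffices once `x < b`.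
  verticesWithin : ℕ → ∀ x → List (Vert x)
  verticesWithin zero    x = []
  verticesWithin (suc b) x = List.map rim (allFin (ring x)) ++ List.map tip (allFin (ring x)) ++
    concatMap (λ y → copies x y (verticesWithin b y)) (upTo x)

  ∈-verticesWithin : ∀ {b} → x < b → (u : Vert x) → u ∈ verticesWithin b x
  ∈-verticesWithin {b = suc b} x<b (rim i) = ∈-++⁺ˡ (∈-map⁺ rim (∈-allFin i))
  ∈-verticesWithin {x} {b = suc b} x<b (tip i) = ∈-++⁺ʳ (List.map rim (allFin (ring x)))
    (∈-++⁺ˡ (∈-map⁺ tip (∈-allFin i)))
  ∈-verticesWithin {x} {b = suc b} (s≤s x≤b) (copy y y≺x u) =
    ∈-++⁺ʳ (List.map rim (allFin (ring x))) (∈-++⁺ʳ (List.map tip (allFin (ring x)))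
      (∈-concatMap⁺ _ (lose (∈-upTo⁺ y<x) (∈-copies y≺x (∈-verticesWithin (<-≤-trans y<x x≤b) u)))))
    where y<x = proj₁ (≺-recompute y≺x)

  vertices : ∀ x → List (Vert x)
  vertices x = verticesWithin (suc x) x

  ∈-vertices : (u : Vert x) → u ∈ vertices x
  ∈-vertices = ∈-verticesWithin ≤-refl

  finiteGraph : ℕ → FiniteGraph
  finiteGraph x = record
    { V        = Vert x
    ; vertices = vertices x
    ; complete = ∈-vertices
    ; _∼_      = _~_
    ; ∼-sym    = ~-sym
    }

  ⊑⇒≤LI′ : ∀ {x x′} → x ⊑ x′ → finiteGraph x ≤LI′ finiteGraph x′
  ⊑⇒≤LI′ x⊑x′ with f , f-edge ← ⊑⇒map x⊑x′ = record
    { to  = f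
    ; hom = λ (l , e) → l , f-edge e
    -- If two neighbours have the same image, the image edges coincide and so have one label; the
    -- original edges then share it too.
    ; inj = λ {u} (l , e) (l′ , e′) eq →
        inj-edge e e′ (Edge-label (f-edge e) (subst (Edge l′ (f u)) (sym eq) (f-edge e′)))
    }
    where
    inj-edge : Edge l u v → Edge l′ u w → l ≡ l′ → v ≡ w
    inj-edge e e′ refl = Edge-functional e e′

  -- Ring vertices at any depth of nesting

  data Core : Vert x → Set where
    rim  : Core {x} (rim i)
    copy : ∀ {u : Vert y} .{y≺x : y ≺ x} → Core u → Core (copy y y≺x u)

  -- The index of the innermost copy that contains the vertex.
  base : Vert x → ℕ
  base {x} (rim _)      = x
  base {x} (tip _)      = x
  base     (copy _ _ u) = base u

  position : Vert x → ℕ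
  position (rim i)      = toℕ i
  position (tip i)      = toℕ i
  position (copy _ _ u) = position u

  base-⊑ : (u : Vert x) → base u ⊑ x
  base-⊑ (rim _)        = ⊑-refl
  base-⊑ (tip _)        = ⊑-refl
  base-⊑ (copy _ y≺x u) = ⊑-trans (base-⊑ u) (proj₂ (≺-recompute y≺x))

  position< : (u : Vert x) → position u < ring (base u)
  position< (rim i)      = toℕ<n i
  position< (tip i)      = toℕ<n i
  position< (copy _ _ u) = position< u

  next-base : Edge next u v → base u ≡ base v
  next-base (next _)  = refl
  next-base (inner e) = next-base e

  next-position : Edge next u v → position v ≡ suc (position u) % ring (base u)
  next-position (next p)  = p
  next-position (inner e) = next-position e

  data Rotation : Label → Set where
    next : Rotation next
    prev : Rotation prev

  -- Together with `Edge-functional`, the second alternative says that tips have degree at most 2,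
  -- also when a copy is attached there from outside.
  core⊎tip : (u : Vert x) → Core u ⊎ (∀ {l v} → Edge l u v → l ≡ spoke ⊎ l ≡ link)
  core⊎tip (rim _) = inj₁ rim
  core⊎tip (tip _) = inj₂ λ where
    back       → inj₁ refl
    (loop _)   → inj₂ refl
    (down _ _) → inj₂ refl
  core⊎tip (copy y y≺x u) with core⊎tip u
  ... | inj₁ c = inj₁ (copy c)
  ... | inj₂ g = inj₂ λ where
    (up _ _)  → inj₂ refl
    (inner e) → g e

  core-edge : Core u → Core v → Edge l u v → Rotation l
  core-edge rim rim (next _) = next
  core-edge rim rim (prev _) = prev
  core-edge (copy c) (copy c′) (inner e) = core-edge c c′ e

  rimAt : ℕ → Vert x
  rimAt {x} t = rim (t mod ring x)

  rimAt-next : ∀ t → Edge {x} next (rimAt t) (rimAt (suc t))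
  rimAt-next {x} t = next (begin
    toℕ (suc t mod ring x)           ≡⟨ toℕ-mod (suc t) (ring x) ⟩
    suc t % ring x                   ≡⟨ suc-%-% t (ring x) ⟨
    suc (t % ring x) % ring x        ≡⟨ cong (λ n → suc n % ring x) (toℕ-mod t (ring x)) ⟨
    suc (toℕ (t mod ring x)) % ring x  ∎)
    where open ≡-Reasoning

  rimAt-prev : ∀ t → Edge {x} prev (rimAt (suc t)) (rimAt t)
  rimAt-prev t = Edge-sym (rimAt-next t)

  rimAt-toℕ : (i : Fin (ring x)) → rimAt (toℕ i) ≡ rim i
  rimAt-toℕ {x} i = cong rim (toℕ-injective
    (trans (toℕ-mod (toℕ i) (ring x)) (m<n⇒m%n≡m (toℕ<n i))))

  rimAt-period : ∀ t → rimAt {x} (t + ring x) ≡ rimAt t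
  rimAt-period {x} t = cong rim (toℕ-injective (begin
    toℕ ((t + ring x) mod ring x)  ≡⟨ toℕ-mod (t + ring x) (ring x) ⟩
    (t + ring x) % ring x          ≡⟨ [m+n]%n≡m%n t (ring x) ⟩
    t % ring x                     ≡⟨ toℕ-mod t (ring x) ⟨
    toℕ (t mod ring x)             ∎))
    where open ≡-Reasoning

  root : Vert x
  root = rimAt 0

  rimAt⇝root : ∀ t → Star (_~_ {x}) (rimAt t) root
  rimAt⇝root zero    = ε
  rimAt⇝root (suc t) = (prev , rimAt-prev t) ◅ rimAt⇝root t

  rim⇝root : (i : Fin (ring x)) → Star _~_ (rim i) root
  rim⇝root i = subst (λ u → Star _~_ u root) (rimAt-toℕ i) (rimAt⇝root (toℕ i))

  tip⇝root : (i : Fin (ring x)) → Star _~_ (tip i) root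
  tip⇝root i = (spoke , back) ◅ rim⇝root i

  _⇝root : (u : Vert x) → Star _~_ u root
  rim i ⇝root = rim⇝root i
  tip i ⇝root = tip⇝root i
  _⇝root {x} (copy y y≺x u) =
    gmap (copy y y≺x) (λ (l , e) → l , inner e)
      (u ⇝root ◅◅ reverse ~-sym (tip⇝root (fromℕ< inside-y)))
    ◅◅ (link , up (toℕ-fromℕ< inside-x) (toℕ-fromℕ< inside-y))
    ◅ tip⇝root (fromℕ< inside-x)
    where
    inside-y : slot y < ring y
    inside-y = slot<ring ≤-refl
    inside-x : slot y < ring x
    inside-x = slot<ring (<⇒≤ (proj₁ (≺-recompute y≺x)))

  infixr 5 _∷_
  data Walk {x} : ℕ → Vert x → Vert x → Set where
    []  : ∀ {u} → Walk 0 u u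
    _∷_ : ∀ {n u v w} → Edge next u v → Walk n v w → Walk (suc n) u w

  walk-position : ∀ {n} → Walk n u v → ∀ {b} → base u ≡ b →
                  position v ≡ (position u + n) % ring b
  walk-position {u = u} [] refl = sym (begin
    (position u + 0) % ring (base u)  ≡⟨ cong (_% ring (base u)) (+-identityʳ (position u)) ⟩
    position u % ring (base u)        ≡⟨ m<n⇒m%n≡m (position< u) ⟩
    position u                        ∎)
    where open ≡-Reasoning
  walk-position {u = u} {v = w} {n = suc n} (_∷_ {v = v} e es) refl = begin
    position w                           ≡⟨ walk-position es (sym (next-base e)) ⟩
    (position v + n) % r                 ≡⟨ cong (λ p → (p + n) % r) (next-position e) ⟩
    (suc (position u) % r + n) % r       ≡⟨ %-distribˡ-+ (suc (position u) % r) n r ⟩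
    (suc (position u) % r % r + n % r) % r  ≡⟨ cong (λ p → (p + n % r) % r) (m%n%n≡m%n (suc (position u)) r) ⟩
    (suc (position u) % r + n % r) % r   ≡⟨ %-distribˡ-+ (suc (position u)) n r ⟨
    (suc (position u) + n) % r           ≡⟨ cong (_% r) (+-suc (position u) n) ⟨
    (position u + suc n) % r             ∎
    where
    open ≡-Reasoning
    r = ring (base u)

  closed-walk-∣ : ∀ {n} → Walk n u u → ring (base u) ∣ n
  closed-walk-∣ {u = u} {n} es = [a+t]%d≡a%d⇒d∣t (position u) n (ring (base u))
    (trans (sym (walk-position es refl)) (sym (m<n⇒m%n≡m (position< u))))

  walk-along : (q : ℕ → Vert x) → (∀ t → Edge next (q t) (q (suc t))) → ∀ n → Walk n (q 0) (q n)
  walk-along q e zero    = []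
  walk-along q e (suc n) = e 0 ∷ walk-along (q ∘ suc) (e ∘ suc) n

  walk-back : (q : ℕ → Vert x) → (∀ t → Edge prev (q t) (q (suc t))) → ∀ n → Walk n (q n) (q 0)
  walk-back q e zero    = []
  walk-back q e (suc n) = Edge-sym (e n) ∷ walk-back q e n

  turn : Rotation l → Rotation l′ → l′ ≡ l ⊎ l′ ≡ opposite l
  turn next next = inj₁ refl
  turn next prev = inj₂ refl
  turn prev next = inj₂ refl
  turn prev prev = inj₁ refl

  module _ {x x′} (F : finiteGraph x ≤LI′ finiteGraph x′) where
    open _≤LI′_ F renaming (to to f)

    labels-distinct : Edge l u v → Edge l′ u w → l ≢ l′ → ∀ {m} →
                      Edge m (f u) (f v) → ¬ Edge m (f u) (f w)
    labels-distinct e e′ l≢l′ d d′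
      with refl ← inj (_ , e) (_ , e′) (Edge-functional d d′) = l≢l′ (Edge-label e e′)

    -- The shift by one gives every vertex of the ring a predecessor.
    q : ℕ → Vert x′
    q t = f (rimAt (suc t))

    -- The three neighbours of a ring vertex cannot fit around a tip, which has
    -- only the labels spoke and link.
    q-core : ∀ t → Core (q t)
    q-core t with core⊎tip (q t)
    ... | inj₁ c = c
    ... | inj₂ g with hom (next , n) | hom (prev , p) | hom (spoke , out)
      where
      n = rimAt-next {x} (suc t)
      p = rimAt-prev {x} t
    ... | l₁ , e₁ | l₂ , e₂ | l₃ , e₃ with g e₁ | g e₂ | g e₃
    ... | inj₁ refl | inj₁ refl | _ = contradiction e₂ (labels-distinct (rimAt-next (suc t)) (rimAt-prev t) (λ ()) e₁)
    ... | inj₂ refl | inj₂ refl | _ = contradiction e₂ (labels-distinct (rimAt-next (suc t)) (rimAt-prev t) (λ ()) e₁)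
    ... | inj₁ refl | _ | inj₁ refl = contradiction e₃ (labels-distinct (rimAt-next (suc t)) out (λ ()) e₁)
    ... | inj₂ refl | _ | inj₂ refl = contradiction e₃ (labels-distinct (rimAt-next (suc t)) out (λ ()) e₁)
    ... | _ | inj₁ refl | inj₁ refl = contradiction e₃ (labels-distinct (rimAt-prev t) out (λ ()) e₂)
    ... | _ | inj₂ refl | inj₂ refl = contradiction e₃ (labels-distinct (rimAt-prev t) out (λ ()) e₂)

    q-rotation : ∀ t → ∃[ l ] Rotation l × Edge l (q t) (q (suc t))
    q-rotation t with l , e ← hom (next , rimAt-next (suc t)) =
      l , core-edge (q-core t) (q-core (suc t)) e , e

    q-straight : Rotation l → Edge l (q 0) (q 1) → ∀ t → Edge l (q t) (q (suc t))
    q-straight r e₀ zero = e₀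
    q-straight r e₀ (suc t) with e ← q-straight r e₀ t | l′ , r′ , e′ ← q-rotation (suc t) with turn r r′
    ... | inj₁ refl = e′
    ... | inj₂ refl = contradiction e′
      (labels-distinct (rimAt-prev (suc t)) (rimAt-next (2 + t)) (λ ()) (Edge-sym e))

    q-period : q (ring x) ≡ q 0
    q-period = cong f (rimAt-period 1)

    ring-image-∣ : ring (base (q 0)) ∣ ring x
    ring-image-∣ with q-rotation 0
    ... | next , r , e = closed-walk-∣ (subst (Walk _ (q 0)) q-period (walk-along q (q-straight r e) (ring x)))
    ... | prev , r , e = closed-walk-∣ (subst (λ u → Walk _ u (q 0)) q-period (walk-back q (q-straight r e) (ring x)))

    ≤LI′⇒⊑ : x ⊑ x′
    ≤LI′⇒⊑ = ⊑-trans (ring-∣⇒⊑ ring-image-∣) (base-⊑ (q 0))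

lower-em : ∀ {a} b → ExcludedMiddle (a ⊔ b) → ExcludedMiddle a
lower-em b em {P} = map′ lower lift (em {Lift b P})

module _ {_⊑_ : Rel ℕ 0ℓ} (em : ExcludedMiddle 0ℓ) (isDecPartialOrder : IsDecPartialOrder _≡_ _⊑_) where
  open Construction isDecPartialOrder

  embed : ℕ → ConnGraph
  embed x = record { graph = graph; connected = connected root _⇝root }
    where open Realisation em (finiteGraph x)

  embed-⇔ : ∀ x y → x ⊑ y ⇔ ConnGraph.graph (embed x) ≤LI ConnGraph.graph (embed y)
  embed-⇔ x y = mk⇔ (≤LI⁺ em {finiteGraph x} ∘ ⊑⇒≤LI′) (≤LI′⇒⊑ ∘ ≤LI⁻ em {_} {finiteGraph y})

module _ {c ℓ₁ ℓ₂} (em : ExcludedMiddle (c ⊔ ℓ₁ ⊔ ℓ₂)) (P : Poset c ℓ₁ ℓ₂) (count : Countable P) where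
  private module P = Poset P
  open Injection count using () renaming (to to #; cong to #-cong; injective to #-injective)

  #-≡⇒≤ : ∀ {a b} → # a ≡ # b → a P.≤ b
  #-≡⇒≤ eq = P.reflexive (#-injective eq)

  -- The equality makes ⊑ᴾ reflexive outside the image of #.
  _⊑ᴾ_ : Rel ℕ (c ⊔ ℓ₁ ⊔ ℓ₂)
  m ⊑ᴾ n = Lift (c ⊔ ℓ₁ ⊔ ℓ₂) (m ≡ n) ⊎ Lift ℓ₁ (∃[ a ] ∃[ b ] # a ≡ m × # b ≡ n × a P.≤ b)

  ⊑ᴾ-trans : ∀ {l m n} → l ⊑ᴾ m → m ⊑ᴾ n → l ⊑ᴾ n
  ⊑ᴾ-trans (inj₁ (lift refl)) q = q
  ⊑ᴾ-trans p (inj₁ (lift refl)) = p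
  ⊑ᴾ-trans (inj₂ (lift (a , b , #a , #b , a≤b))) (inj₂ (lift (b′ , d , #b′ , #d , b′≤d))) =
    inj₂ (lift (a , d , #a , #d , P.trans a≤b (P.trans (#-≡⇒≤ (trans #b (sym #b′))) b′≤d)))

  #-reflects-≤ : ∀ {a b} → # a ⊑ᴾ # b → a P.≤ b
  #-reflects-≤ (inj₁ (lift eq)) = #-≡⇒≤ eq
  #-reflects-≤ (inj₂ (lift (a′ , b′ , #a′ , #b′ , a′≤b′))) =
    P.trans (#-≡⇒≤ (sym #a′)) (P.trans a′≤b′ (#-≡⇒≤ #b′))

  ⊑ᴾ-antisym : ∀ {m n} → m ⊑ᴾ n → n ⊑ᴾ m → m ≡ n
  ⊑ᴾ-antisym (inj₁ (lift eq)) q = eq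
  ⊑ᴾ-antisym (inj₂ (lift (a , b , refl , refl , a≤b))) q =
    #-cong (P.antisym a≤b (#-reflects-≤ q))

  _⊑_ : Rel ℕ 0ℓ
  m ⊑ n = True (em {m ⊑ᴾ n})

  #-⇔ : ∀ a b → a P.≤ b ⇔ # a ⊑ # b
  #-⇔ a b = mk⇔ (λ a≤b → fromWitness (inj₂ (lift (a , b , refl , refl , a≤b))))
                (#-reflects-≤ ∘ toWitness)

  ⊑-isDecPartialOrder : IsDecPartialOrder _≡_ _⊑_
  ⊑-isDecPartialOrder = record
    { isPartialOrder = record
      { isPreorder = record
        { isEquivalence = ≡.isEquivalence
        ; reflexive     = λ eq → fromWitness (inj₁ (lift eq))
        ; trans         = λ p q → fromWitness (⊑ᴾ-trans (toWitness p) (toWitness q))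
        }
      ; antisym = λ p q → ⊑ᴾ-antisym (toWitness p) (toWitness q)
      }
    ; _≟_  = _≟_
    ; _≤?_ = λ m n → T? _
    }

  countable⇒embeds : EmbedsInto P ConnGraph-poset
  countable⇒embeds = embed em₀ ⊑-isDecPartialOrder ∘ # ,
    λ a b → embed-⇔ em₀ ⊑-isDecPartialOrder (# a) (# b) ⇔-∘ #-⇔ a b
    where
    em₀ : ExcludedMiddle 0ℓ
    em₀ = lower-em (c ⊔ ℓ₁ ⊔ ℓ₂) em

theorem5p7p14 : ∀ {c ℓ₁ ℓ₂} → ExcludedMiddle (c ⊔ ℓ₁ ⊔ ℓ₂) → Universal c ℓ₁ ℓ₂ ConnGraph-poset
theorem5p7p14 {c} {ℓ₁} {ℓ₂} em =
  ConnGraph-countable (lower-em (c ⊔ ℓ₁ ⊔ ℓ₂) em) , countable⇒embeds em
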